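{- Let $s$ be a term such that $s\succ^k t$ for some abstraction $t$. Then $\tau_s\succ^{3k+1}([],[P])$ in the substitution machine for some program $P$ with $P\gg t$.
   Context: Terms (de Bruijn): $s::=n\mid st\mid\lambda s$. Term substitution: $k^k_u=u$, $n^k_u=n$ ($n\ne k$), $(st)^k_u=(s^k_u)(t^k_u)$, $(\lambda s)^k_u=\lambda(s^{k+1}_u)$. Reduction $\succ$: $(\lambda s)(\lambda t)\succ s^0_{\lambda t}$; $s\succ s'\Rightarrow st\succ s't$; $t\succ t'\Rightarrow(\lambda s)t\succ(\lambda s)t'$; $\succ^k$ is $k$-fold reduction. Programs are lists of commands $\mathsf{ret},\mathsf{var}\,n,\mathsf{lam},\mathsf{app}$. Compilation: $\gamma n=[\mathsf{var}\,n]$, $\gamma(st)=\gamma s++\gamma t++[\mathsf{app}]$, $\gamma(\lambda s)=\mathsf{lam}::\gamma s++[\mathsf{ret}]$. $P\gg s$ holds iff $P=\gamma u$ and $s=\lambda u$ for some $u$. $\varphi P:=\varphi_{0,[]}P$ with $\varphi_{0,Q}(\mathsf{ret}::P)=(Q,P)$, $\varphi_{k+1,Q}(\mathsf{ret}::P)=\varphi_{k,Q++[\mathsf{ret}]}P$, $\varphi_{k,Q}(\mathsf{lam}::P)=\varphi_{k+1,Q++[\mathsf{lam}]}P$, $\varphi_{k,Q}(c::P)=\varphi_{k,Q++[c]}P$ for $c$ a $\mathsf{var}$ or $\mathsf{app}$, undefined otherwise. Program substitution: $(\mathsf{var}\,k::P)^k_Q=Q++P^k_Q$; $(\mathsf{var}\,n::P)^k_Q=\mathsf{var}\,n::P^k_Q$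 ($n\ne k$); $(\mathsf{lam}::P)^k_Q=\mathsf{lam}::P^{k+1}_Q$; $(\mathsf{app}::P)^k_Q=\mathsf{app}::P^k_Q$; $(\mathsf{ret}::P)^0_Q=[\mathsf{ret}]$; $(\mathsf{ret}::P)^{k+1}_Q=\mathsf{ret}::P^k_Q$; $[]^k_Q=[]$. The substitution machine has states $(T,V)$ with $T,V$ lists of programs, and steps: $((\mathsf{lam}::P)::T,V)\succ(P'::_{tc}T,\ Q::V)$ if $\varphi P=(Q,P')$; $((\mathsf{app}::P)::T,\ Q::R::V)\succ(R^0_{\mathsf{lam}::Q++[\mathsf{ret}]}::(P::_{tc}T),\ V)$; where $P::_{tc}T:=T$ if $P=[]$ and $P::T$ otherwise. The initial state is $\tau_s:=([\gamma s],[])$. -}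

module Defs where

open import Data.Bool using (if_then_else_)
open import Data.List using (List; []; _∷_; _++_; [_])
open import Data.Maybe using (Maybe; just; nothing)
open import Data.Nat using (ℕ; zero; suc; _≟_)
open import Data.Product using (_×_; _,_; ∃-syntax)
open import Level using (0ℓ)
open import Relation.Binary.Core using (Rel)
open import Relation.Binary.PropositionalEquality using (_≡_)
open import Relation.Nullary using (does)

infixl 8 _^ᴿ_
infixl 7 _·_
infixr 6 ƛ_
infixr 5 _∷ᵗᶜ_
infix  4 _≻_ _≻ₘ_ _≫_

_^ᴿ_ : {A : Set} → Rel A 0ℓ → ℕ → Rel A 0ℓ
(R ^ᴿ zero)  x z = x ≡ z
(R ^ᴿ suc k) x z = ∃[ y ] (R x y × (R ^ᴿ k) y z)

data Term : Set where
  #_  : ℕ → Term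
  _·_ : Term → Term → Term
  ƛ_  : Term → Term

Abstraction : Term → Set
Abstraction s = ∃[ u ] s ≡ ƛ u

-- substTerm s k u is s^k_u.  The substituted term u is not shifted under
-- binders, so capture is possible when u is open.
substTerm : Term → ℕ → Term → Term
substTerm (# n)   k u = if does (n ≟ k) then u else # n
substTerm (s · t) k u = substTerm s k u · substTerm t k u
substTerm (ƛ s)   k u = ƛ substTerm s (suc k) u

data _≻_ : Rel Term 0ℓ where
  β  : ∀ {s t} → (ƛ s) · (ƛ t) ≻ substTerm s 0 (ƛ t)
  ξˡ : ∀ {s s′ t} → s ≻ s′ → s · t ≻ s′ · t
  ξʳ : ∀ {s t t′} → t ≻ t′ → (ƛ s) · t ≻ (ƛ s) · t′

data Com : Set where
  ret : Com
  var : ℕ → Com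
  lam : Com
  app : Com

Program : Set
Program = List Com

γ : Term → Program
γ (# n)   = [ var n ]
γ (s · t) = γ s ++ γ t ++ [ app ]
γ (ƛ s)   = lam ∷ γ s ++ [ ret ]

_≫_ : Program → Term → Set
P ≫ s = ∃[ u ] (P ≡ γ u × s ≡ ƛ u)

-- φ-from k Q P is φ_{k,Q} P.
φ-from : ℕ → Program → Program → Maybe (Program × Program)
φ-from k       Q []          = nothing
φ-from zero    Q (ret ∷ P)   = just (Q , P)
φ-from (suc k) Q (ret ∷ P)   = φ-from k (Q ++ [ ret ]) P
φ-from k       Q (lam ∷ P)   = φ-from (suc k) (Q ++ [ lam ]) P
φ-from k       Q (var n ∷ P) = φ-from k (Q ++ [ var n ]) P
φ-from k       Q (app ∷ P)   = φ-from k (Q ++ [ app ]) P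

φ : Program → Maybe (Program × Program)
φ = φ-from 0 []

-- substProgram P k Q is P^k_Q.  A ret at depth 0 ends the program, and any
-- commands after it are dropped.
substProgram : Program → ℕ → Program → Program
substProgram []          k       Q = []
substProgram (var n ∷ P) k       Q =
  if does (n ≟ k) then Q ++ substProgram P k Q else var n ∷ substProgram P k Q
substProgram (lam ∷ P)   k       Q = lam ∷ substProgram P (suc k) Q
substProgram (app ∷ P)   k       Q = app ∷ substProgram P k Q
substProgram (ret ∷ P)   zero    Q = [ ret ]
substProgram (ret ∷ P)   (suc k) Q = ret ∷ substProgram P k Q

_∷ᵗᶜ_ : Program → List Program → List Program
[]      ∷ᵗᶜ T = T
(c ∷ P) ∷ᵗᶜ T = (c ∷ P) ∷ T

State : Set
State = List Program × List Program

data _≻ₘ_ : Rel State 0ℓ where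
  push : ∀ {P P′ Q T V} → φ P ≡ just (Q , P′) →
         ((lam ∷ P) ∷ T , V) ≻ₘ (P′ ∷ᵗᶜ T , Q ∷ V)
  beta : ∀ {P Q R T V} →
         ((app ∷ P) ∷ T , Q ∷ R ∷ V) ≻ₘ
         (substProgram R 0 (lam ∷ Q ++ [ ret ]) ∷ (P ∷ᵗᶜ T) , V)

τ : Term → State
τ s = [ γ s ] , []

{-# OPTIONS --safe #-}

-- Small-step reduction to an abstraction is first turned into a big-step
-- judgement counting β-steps.  An application whose three sub-evaluations cost
-- 3k₁+1, 3k₂+1 and 3k₃+1 machine steps costs their sum plus one beta step, which
-- is 3(k₁+k₂+k₃+1)+1; an abstraction costs a single push.

module Submission where

open import Defs
open import Data.Bool using (true; false)
open import Data.List using ([]; [_]; _∷_; _++_)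
open import Data.List.Properties using (++-assoc; ++-identityʳ)
open import Data.Nat using (ℕ; zero; suc; _+_; _*_; _≟_)
open import Data.Nat.Tactic.RingSolver using (solve-∀)
open import Data.Product using (_×_; _,_; ∃-syntax)
open import Level using (0ℓ)
open import Relation.Binary.Core using (Rel)
open import Relation.Binary.PropositionalEquality
  using (_≡_; refl; sym; trans; cong; subst; subst₂; module ≡-Reasoning)
open import Relation.Nullary using (does)

open ≡-Reasoning

infix 4 _⇓[_]_

^ᴿ-trans : ∀ {A : Set} {R : Rel A 0ℓ} m {n x y z} →
           (R ^ᴿ m) x y → (R ^ᴿ n) y z → (R ^ᴿ (m + n)) x z
^ᴿ-trans zero    refl           Rⁿyz = Rⁿyz
^ᴿ-trans (suc m) (w , Rxw , Rᵐ) Rⁿyz = w , Rxw , ^ᴿ-trans m Rᵐ Rⁿyz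

γ-·-++ : ∀ s t P → γ (s · t) ++ P ≡ γ s ++ γ t ++ app ∷ P
γ-·-++ s t P = trans (++-assoc (γ s) _ P) (cong (γ s ++_) (++-assoc (γ t) _ P))

γ-ƛ-++ : ∀ s P → γ (ƛ s) ++ P ≡ lam ∷ γ s ++ ret ∷ P
γ-ƛ-++ s P = cong (lam ∷_) (++-assoc (γ s) _ P)

-- The trailing `P` makes the induction go through. Compiled code is balanced: the `ret` closing an
-- abstraction meets depth `suc k`, so it never truncates, and `P` is reached at depth `k` again.
substProgram-γ : ∀ s u k P → substProgram (γ s ++ P) k (γ u) ≡
                 γ (substTerm s k u) ++ substProgram P k (γ u)
substProgram-γ (# n) u k P with does (n ≟ k)
... | true  = refl
... | false = refl
substProgram-γ (s · t) u k P = begin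
  substProgram (γ (s · t) ++ P) k (γ u)
    ≡⟨ cong (λ X → substProgram X k (γ u)) (γ-·-++ s t P) ⟩
  substProgram (γ s ++ γ t ++ app ∷ P) k (γ u)
    ≡⟨ substProgram-γ s u k _ ⟩
  γ (substTerm s k u) ++ substProgram (γ t ++ app ∷ P) k (γ u)
    ≡⟨ cong (γ (substTerm s k u) ++_) (substProgram-γ t u k _) ⟩
  γ (substTerm s k u) ++ γ (substTerm t k u) ++ app ∷ substProgram P k (γ u)
    ≡⟨ γ-·-++ (substTerm s k u) (substTerm t k u) _ ⟨
  γ (substTerm (s · t) k u) ++ substProgram P k (γ u) ∎
substProgram-γ (ƛ s) u k P = begin
  substProgram (γ (ƛ s) ++ P) k (γ u)
    ≡⟨ cong (λ X → substProgram X k (γ u)) (γ-ƛ-++ s P) ⟩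
  lam ∷ substProgram (γ s ++ ret ∷ P) (suc k) (γ u)
    ≡⟨ cong (lam ∷_) (substProgram-γ s u (suc k) _) ⟩
  lam ∷ γ (substTerm s (suc k) u) ++ ret ∷ substProgram P k (γ u)
    ≡⟨ γ-ƛ-++ (substTerm s (suc k) u) _ ⟨
  γ (substTerm (ƛ s) k u) ++ substProgram P k (γ u) ∎

substProgram-γ-[] : ∀ s u k →
                    substProgram (γ s) k (γ u) ≡ γ (substTerm s k u)
substProgram-γ-[] s u k = begin
  substProgram (γ s) k (γ u)
    ≡⟨ cong (λ X → substProgram X k (γ u)) (++-identityʳ (γ s)) ⟨
  substProgram (γ s ++ []) k (γ u)
    ≡⟨ substProgram-γ s u k [] ⟩
  γ (substTerm s k u) ++ []
    ≡⟨ ++-identityʳ _ ⟩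
  γ (substTerm s k u) ∎

-- φ-from matches on its depth before the command, so these equations do not
-- hold definitionally at a variable depth.
φ-from-var : ∀ k Q n P →
             φ-from k Q (var n ∷ P) ≡ φ-from k (Q ++ [ var n ]) P
φ-from-var zero    Q n P = refl
φ-from-var (suc k) Q n P = refl

φ-from-app : ∀ k Q P → φ-from k Q (app ∷ P) ≡ φ-from k (Q ++ [ app ]) P
φ-from-app zero    Q P = refl
φ-from-app (suc k) Q P = refl

φ-from-lam : ∀ k Q P → φ-from k Q (lam ∷ P) ≡ φ-from (suc k) (Q ++ [ lam ]) P
φ-from-lam zero    Q P = refl
φ-from-lam (suc k) Q P = refl

-- Balance again: every `lam` in `γ s` is undone by its own `ret`, so the scan cannot stop inside
-- `γ s`.
φ-from-γ : ∀ s k Q P → φ-from k Q (γ s ++ P) ≡ φ-from k (Q ++ γ s) P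
φ-from-γ (# n) k Q P = φ-from-var k Q n P
φ-from-γ (s · t) k Q P = begin
  φ-from k Q (γ (s · t) ++ P)
    ≡⟨ cong (φ-from k Q) (γ-·-++ s t P) ⟩
  φ-from k Q (γ s ++ γ t ++ app ∷ P)
    ≡⟨ φ-from-γ s k Q _ ⟩
  φ-from k (Q ++ γ s) (γ t ++ app ∷ P)
    ≡⟨ φ-from-γ t k _ _ ⟩
  φ-from k ((Q ++ γ s) ++ γ t) (app ∷ P)
    ≡⟨ φ-from-app k _ P ⟩
  φ-from k (((Q ++ γ s) ++ γ t) ++ [ app ]) P
    ≡⟨ cong (λ X → φ-from k X P)
         (trans (++-assoc (Q ++ γ s) (γ t) _) (++-assoc Q (γ s) _)) ⟩
  φ-from k (Q ++ γ (s · t)) P ∎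
φ-from-γ (ƛ s) k Q P = begin
  φ-from k Q (γ (ƛ s) ++ P)
    ≡⟨ cong (φ-from k Q) (γ-ƛ-++ s P) ⟩
  φ-from k Q (lam ∷ γ s ++ ret ∷ P)
    ≡⟨ φ-from-lam k Q _ ⟩
  φ-from (suc k) (Q ++ [ lam ]) (γ s ++ ret ∷ P)
    ≡⟨ φ-from-γ s (suc k) _ _ ⟩
  φ-from k (((Q ++ [ lam ]) ++ γ s) ++ [ ret ]) P
    ≡⟨ cong (λ X → φ-from k X P)
         (trans (++-assoc (Q ++ [ lam ]) (γ s) _) (++-assoc Q [ lam ] _)) ⟩
  φ-from k (Q ++ γ (ƛ s)) P ∎

-- Compiled code is never empty, so `∷ᵗᶜ` has nothing to drop.
γ-++-∷ᵗᶜ : ∀ s P T → (γ s ++ P) ∷ᵗᶜ T ≡ (γ s ++ P) ∷ T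
γ-++-∷ᵗᶜ (# n)   P T = refl
γ-++-∷ᵗᶜ (s · t) P T rewrite γ-·-++ s t P = γ-++-∷ᵗᶜ s _ T
γ-++-∷ᵗᶜ (ƛ s)   P T = refl

-- s ⇓[ k ] u means that s evaluates to ƛ u, performing k β-reductions.
data _⇓[_]_ : Term → ℕ → Term → Set where
  ⇓-ƛ : ∀ {u} → ƛ u ⇓[ 0 ] u
  ⇓-· : ∀ {s t u v w k₁ k₂ k₃} →
        s ⇓[ k₁ ] u → t ⇓[ k₂ ] v → substTerm u 0 (ƛ v) ⇓[ k₃ ] w →
        s · t ⇓[ suc (k₁ + k₂ + k₃) ] w

≻-⇓ : ∀ {s s′ k u} → s ≻ s′ → s′ ⇓[ k ] u → s ⇓[ suc k ] u
≻-⇓ β       e               = ⇓-· ⇓-ƛ ⇓-ƛ e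
≻-⇓ (ξˡ r)  (⇓-· e₁ e₂ e₃)  = ⇓-· (≻-⇓ r e₁) e₂ e₃
-- The function part is an abstraction, so its evaluation can only be `⇓-ƛ`.
≻-⇓ (ξʳ r)  (⇓-· ⇓-ƛ e₂ e₃) = ⇓-· ⇓-ƛ (≻-⇓ r e₂) e₃

≻^-⇓ : ∀ {s u} k → (_≻_ ^ᴿ k) s (ƛ u) → s ⇓[ k ] u
≻^-⇓ zero    refl         = ⇓-ƛ
≻^-⇓ (suc k) (_ , r , rs) = ≻-⇓ r (≻^-⇓ k rs)

·-steps : ∀ a b c → (3 * a + 1) + ((3 * b + 1) + suc (3 * c + 1)) ≡
                    3 * suc (a + b + c) + 1
·-steps = solve-∀

-- An arbitrary continuation `P` and stacks `T`, `V` are needed because subterms of an application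
-- run in the middle of a program.
⇓-machine : ∀ {s k u} → s ⇓[ k ] u → ∀ P T V →
            (_≻ₘ_ ^ᴿ (3 * k + 1)) ((γ s ++ P) ∷ T , V) (P ∷ᵗᶜ T , γ u ∷ V)
⇓-machine (⇓-ƛ {u}) P T V =
  -- After `γ u` the scan is back at depth 0, so the next `ret` ends the body and leaves exactly
  -- `P`.
  _ , push (trans (cong φ (++-assoc (γ u) _ P)) (φ-from-γ u 0 [] _)) , refl
⇓-machine (⇓-· {s} {t} {u} {v} {w} {k₁} {k₂} {k₃} e₁ e₂ e₃) P T V =
  subst₂ (λ n X → (_≻ₘ_ ^ᴿ n) (X ∷ T , V) (P ∷ᵗᶜ T , γ w ∷ V))
    (·-steps k₁ k₂ k₃) (sym (γ-·-++ s t P))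
    (^ᴿ-trans (3 * k₁ + 1) run-s
      (^ᴿ-trans (3 * k₂ + 1) run-t (_ , beta , run-body)))
  where
  run-s : (_≻ₘ_ ^ᴿ (3 * k₁ + 1)) ((γ s ++ γ t ++ app ∷ P) ∷ T , V)
                                 ((γ t ++ app ∷ P) ∷ T , γ u ∷ V)
  run-s = subst (λ X → (_≻ₘ_ ^ᴿ (3 * k₁ + 1)) ((γ s ++ γ t ++ app ∷ P) ∷ T , V)
                                               (X , γ u ∷ V))
            (γ-++-∷ᵗᶜ t _ T) (⇓-machine e₁ _ T V)

  run-t : (_≻ₘ_ ^ᴿ (3 * k₂ + 1)) ((γ t ++ app ∷ P) ∷ T , γ u ∷ V)
                                 ((app ∷ P) ∷ T , γ v ∷ γ u ∷ V)
  run-t = ⇓-machine e₂ _ T _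

  run-body : (_≻ₘ_ ^ᴿ (3 * k₃ + 1))
               (substProgram (γ u) 0 (γ (ƛ v)) ∷ (P ∷ᵗᶜ T) , V)
               (P ∷ᵗᶜ T , γ w ∷ V)
  -- The code inserted by `beta` is `γ (ƛ v)` by definition. The contracted body is a program of its
  -- own, so its continuation is `[]`, and finishing it exposes `P ∷ᵗᶜ T`.
  run-body = subst (λ X → (_≻ₘ_ ^ᴿ (3 * k₃ + 1)) (X ∷ (P ∷ᵗᶜ T) , V)
                                               (P ∷ᵗᶜ T , γ w ∷ V))
               (trans (++-identityʳ (γ (substTerm u 0 (ƛ v))))
                      (sym (substProgram-γ-[] u (ƛ v) 0)))
               (⇓-machine e₃ [] (P ∷ᵗᶜ T) V)

theorem14 : ∀ (s t : Term) (k : ℕ) → Abstraction t → (_≻_ ^ᴿ k) s t →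
    ∃[ P ] ((_≻ₘ_ ^ᴿ (3 * k + 1)) (τ s) ([] , [ P ]) × P ≫ t)
theorem14 s t k (u , refl) s≻ᵏt =
  γ u ,
  subst (λ X → (_≻ₘ_ ^ᴿ (3 * k + 1)) ([ X ] , []) ([] , [ γ u ]))
    (++-identityʳ (γ s)) (⇓-machine (≻^-⇓ k s≻ᵏt) [] [] []) ,
  u , refl , refl
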